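{- Let $t$ be a closed term and $\pi\triangleright\ \vdash^{(m,e)} t:\mathtt{n}$ a derivation (with empty type context) in the silly multi type system. Then there is a $\to_w$-normal term $n$ and a reduction sequence $d: t\to_y^* n$ such that the number of $\to_{ym}$ steps in $d$ is exactly $m$ and the number of $\to_{yeAY}$ and $\to_{yeYN}$ steps in $d$ is exactly $e$.
   Context: Terms: $t ::= x \mid \lambda x.t \mid t\,u \mid t[x\backslash u]$ ($t[x\backslash u]$ an explicit substitution binding $x$ in $t$; terms up to $\alpha$). Values $v ::= \lambda x.t$. Substitution contexts $S ::= \langle\cdot\rangle\mid S[x\backslash u]$. Weak contexts $W ::= \langle\cdot\rangle \mid W\,t \mid t\,W \mid t[x\backslash W] \mid W[x\backslash u]$. For a class of contexts $K$, $K\langle\langle t\rangle\rangle$ is plugging without capture of free variables of $t$. Root rules: $S\langle\lambda x.t\rangle u\mapsto_m S\langle t[x\backslash u]\rangle$; $K\langle\langle x\rangle\rangle[x\backslash u]\mapsto_{e_K} K\langle\langle u\rangle\rangle[x\backslash u]$; $t[x\backslash S\langle v\rangle]\mapsto_{gcv} S\langle t\rangle$ if $x\notin\mathrm{fv}(t)$. $\to_w$ is the union of the closures under weak contexts of $\mapsto_m$, $\mapsto_{e_W}$ ($K$ = weak contexts), $\mapsto_{gcv}$. Call-by-silly strategy: answers $a ::= v\mid a[x\backslash a']$; name contexts $N ::= \langle\cdot\rangle\mid N t\mid N[x\backslash t]$; auxiliary contexts $A ::= \langle\cdot\rangle\mid a[x\backslash A]\mid A[x\backslash t]$; silly contexts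 $Y ::= A\langle N\rangle$; $\to_{ym} := Y\langle\mapsto_m\rangle$; $\to_{yeAY} := A\langle\mapsto_{e_Y}\rangle$; $\to_{yeYN} := Y\langle\mapsto_{e_N}\rangle$; $\to_{ygcv}:=Y\langle\mapsto_{gcv}\rangle$; $\to_y$ is their union. Silly multi types: linear types $L ::= \mathtt{n} \mid M\multimap L$; multi types $M ::= [L_i]_{i\in I}$ finite multisets ($\mathbf{0}$ empty, $\uplus$ sum). Type contexts $\Gamma$ map variables to multi types with finite support; $\uplus$ pointwise; $\Gamma\setminus\!\!\setminus x$ sets $x$ to $\mathbf{0}$. Rules: (ax) $x:[L]\vdash^{(0,1)} x:L$; (many) from $(\Gamma_i\vdash^{(m_i,e_i)} t : L_i)_{i\in I}$, $I$ finite possibly empty, infer $\uplus_i\Gamma_i\vdash^{(\sum m_i,\sum e_i)} t : [L_i]_{i\in I}$; ($\mathrm{ax}_\lambda$) $\vdash^{(0,0)}\lambda x.t:\mathtt{n}$; ($\lambda$) from $\Gamma\vdash^{(m,e)}t:L$ infer $\Gamma\setminus\!\!\setminus x\vdash^{(m,e)}\lambda x.t:\Gamma(x)\multimap L$; (@) from $\Gamma\vdash^{(m,e)} t : M\multimap L$ and $\Delta\vdash^{(m',e')} u : M\uplus[\mathtt{n}]$ infer $\Gamma\uplus\Delta\vdash^{(m+m'+1,e+e')} tu : L$; (ES) from $\Gamma\vdash^{(m,e)} t:L$ and $\Delta\vdash^{(m',e')}u:\Gamma(x)\uplus[\mathtt{n}]$ infer $(\Gamma\setminus\!\!\setminus x)\uplus\Delta\vdash^{(m+m',e+e')}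 t[x\backslash u]:L$. -}

module Defs where

open import Data.Fin.Base using (Fin; zero; suc)
open import Data.List.Base using (List; []; _∷_; _++_; [_])
open import Data.List.Relation.Binary.Permutation.Homogeneous using (Permutation)
open import Data.Nat.Base using (ℕ; zero; suc; _+_)
open import Data.Unit.Base using (⊤)
open import Data.Vec.Base as Vec using (Vec; []; _∷_)
open import Data.Vec.Relation.Binary.Pointwise.Inductive using (Pointwise)
open import Function.Base using (id; _∘_)
open import Relation.Binary.Construct.Closure.ReflexiveTransitive using (Star; ε; _◅_)
open import Relation.Nullary.Negation.Core using (¬_)

-- Terms up to α are well-scoped de Bruijn terms: Term n has its free variables
-- among n variables, so closed terms are the elements of Term 0.

infixl 7 _·_
infixl 8 _[∖_]

data Term (n : ℕ) : Set where
  var   : Fin n → Term n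
  ƛ     : Term (suc n) → Term n
  _·_   : Term n → Term n → Term n
  _[∖_] : Term (suc n) → Term n → Term n      -- t[x∖u], with x bound as zero in t

ext : ∀ {i j} → (Fin i → Fin j) → Fin (suc i) → Fin (suc j)
ext ρ zero    = zero
ext ρ (suc x) = suc (ρ x)

rename : ∀ {i j} → (Fin i → Fin j) → Term i → Term j
rename ρ (var x)    = var (ρ x)
rename ρ (ƛ t)      = ƛ (rename (ext ρ) t)
rename ρ (t · u)    = rename ρ t · rename ρ u
rename ρ (t [∖ u ]) = rename (ext ρ) t [∖ rename ρ u ]

wk : ∀ {n} → Term n → Term (suc n)
wk = rename suc

data Value {n : ℕ} : Term n → Set where
  ƛ : ∀ t → Value (ƛ t)

data Answer {n : ℕ} : Term n → Set where
  val : ∀ {v} → Value v → Answer v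
  es  : ∀ {a a′} → Answer a → Answer a′ → Answer (a [∖ a′ ])

-- Ctx i j is the type of weak contexts with outer scope i and hole in scope j.
-- All the other classes of contexts are subclasses of it.

infixl 7 _·ˡ_ _·ʳ_
infixl 8 _[∖_]ˡ _[∖_]ʳ

data Ctx (i : ℕ) : ℕ → Set where
  □      : Ctx i i
  _·ˡ_   : ∀ {j} → Ctx i j → Term i → Ctx i j
  _·ʳ_   : ∀ {j} → Term i → Ctx i j → Ctx i j
  _[∖_]ʳ : ∀ {j} → Term (suc i) → Ctx i j → Ctx i j
  _[∖_]ˡ : ∀ {j} → Ctx (suc i) j → Term i → Ctx i j

infixl 9 _⟨_⟩ _⟨⟨_⟩⟩ _∘ᶜ_

_⟨_⟩ : ∀ {i j} → Ctx i j → Term j → Term i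
□ ⟨ t ⟩            = t
(K ·ˡ u) ⟨ t ⟩     = K ⟨ t ⟩ · u
(s ·ʳ K) ⟨ t ⟩     = s · K ⟨ t ⟩
(s [∖ K ]ʳ) ⟨ t ⟩  = s [∖ K ⟨ t ⟩ ]
(K [∖ u ]ˡ) ⟨ t ⟩  = K ⟨ t ⟩ [∖ u ]

_∘ᶜ_ : ∀ {i j k} → Ctx i j → Ctx j k → Ctx i k
□ ∘ᶜ K′           = K′
(K ·ˡ u) ∘ᶜ K′    = (K ∘ᶜ K′) ·ˡ u
(s ·ʳ K) ∘ᶜ K′    = s ·ʳ (K ∘ᶜ K′)
(s [∖ K ]ʳ) ∘ᶜ K′ = s [∖ K ∘ᶜ K′ ]ʳ
(K [∖ u ]ˡ) ∘ᶜ K′ = (K ∘ᶜ K′) [∖ u ]ˡ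

-- The embedding of the outer scope in the scope of the hole.
lift : ∀ {i j} → Ctx i j → Fin i → Fin j
lift □           = id
lift (K ·ˡ u)    = lift K
lift (s ·ʳ K)    = lift K
lift (s [∖ K ]ʳ) = lift K
lift (K [∖ u ]ˡ) = lift K ∘ suc

-- Plugging without capture.
_⟨⟨_⟩⟩ : ∀ {i j} → Ctx i j → Term i → Term i
K ⟨⟨ t ⟩⟩ = K ⟨ rename (lift K) t ⟩

CtxClass : Set₁
CtxClass = ∀ {i j} → Ctx i j → Set

Weak : CtxClass
Weak _ = ⊤

data Subst {i : ℕ} : ∀ {j} → Ctx i j → Set where
  □  : Subst □
  es : ∀ {j} {S : Ctx (suc i) j} {u} → Subst S → Subst (S [∖ u ]ˡ)

data Name {i : ℕ} : ∀ {j} → Ctx i j → Set where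
  □   : Name □
  app : ∀ {j} {N : Ctx i j} {t} → Name N → Name (N ·ˡ t)
  es  : ∀ {j} {N : Ctx (suc i) j} {t} → Name N → Name (N [∖ t ]ˡ)

data Aux {i : ℕ} : ∀ {j} → Ctx i j → Set where
  □   : Aux □
  esʳ : ∀ {j a} {A : Ctx i j} → Answer a → Aux A → Aux (a [∖ A ]ʳ)
  esˡ : ∀ {j} {A : Ctx (suc i) j} {t} → Aux A → Aux (A [∖ t ]ˡ)

data Silly {i k : ℕ} : Ctx i k → Set where
  silly : ∀ {j} {A : Ctx i j} {N : Ctx j k} → Aux A → Name N → Silly (A ∘ᶜ N)

-- By the variable convention S does not capture the variables of u.
data _↦m_ {n : ℕ} : Term n → Term n → Set where
  root : ∀ {j} {S : Ctx n j} {t u} → Subst S →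
         S ⟨ ƛ t ⟩ · u ↦m S ⟨ t [∖ rename (lift S) u ] ⟩

-- u lives outside the scope of the substituted variable, hence the wk.
data RootE (P : CtxClass) {n : ℕ} : Term n → Term n → Set where
  root : ∀ {j} {K : Ctx (suc n) j} {u} → P K →
         RootE P (K ⟨⟨ var zero ⟩⟩ [∖ u ]) (K ⟨⟨ wk u ⟩⟩ [∖ u ])

-- The terms t with x ∉ fv(t), for x the variable zero, are those of the form wk t.
-- By the variable convention S does not capture the variables of t.
data _↦gcv_ {n : ℕ} : Term n → Term n → Set where
  root : ∀ {j} {S : Ctx n j} {t v} → Subst S → Value v →
         wk t [∖ S ⟨ v ⟩ ] ↦gcv S ⟨⟨ t ⟩⟩

TermRel : Set₁
TermRel = ∀ {n} → Term n → Term n → Set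

data Closure (P : CtxClass) (R : TermRel) {n : ℕ} : Term n → Term n → Set where
  inside : ∀ {j} {K : Ctx n j} {t u} → P K → R t u → Closure P R (K ⟨ t ⟩) (K ⟨ u ⟩)

infix 4 _↦m_ _↦gcv_ _→w_ _→ym_ _→yeAY_ _→yeYN_ _→ygcv_ _→y_ _→y*_

data _→w_ {n : ℕ} (t u : Term n) : Set where
  wm   : Closure Weak _↦m_ t u → t →w u
  we   : Closure Weak (RootE Weak) t u → t →w u
  wgcv : Closure Weak _↦gcv_ t u → t →w u

WNormal : ∀ {n} → Term n → Set
WNormal t = ∀ u → ¬ (t →w u)

_→ym_ _→yeAY_ _→yeYN_ _→ygcv_ : TermRel
_→ym_   = Closure Silly _↦m_
_→yeAY_ = Closure Aux   (RootE Silly)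
_→yeYN_ = Closure Silly (RootE Name)
_→ygcv_ = Closure Silly _↦gcv_

data _→y_ {n : ℕ} (t u : Term n) : Set where
  ym   : t →ym u   → t →y u
  yeAY : t →yeAY u → t →y u
  yeYN : t →yeYN u → t →y u
  ygcv : t →ygcv u → t →y u

_→y*_ : TermRel
_→y*_ = Star _→y_

#m : ∀ {n} {t u : Term n} → t →y* u → ℕ
#m ε            = 0
#m (ym _   ◅ d) = suc (#m d)
#m (yeAY _ ◅ d) = #m d
#m (yeYN _ ◅ d) = #m d
#m (ygcv _ ◅ d) = #m d

#e : ∀ {n} {t u : Term n} → t →y* u → ℕ
#e ε            = 0
#e (ym _   ◅ d) = #e d
#e (yeAY _ ◅ d) = suc (#e d)
#e (yeYN _ ◅ d) = suc (#e d)
#e (ygcv _ ◅ d) = #e d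

-- Finite multisets are lists, identified up to the permutations in _≈ₘ_. Since
-- multi types occur inside linear types, the identification is hereditary.

infixr 6 _⊸_

data Linear : Set where
  𝕟   : Linear
  _⊸_ : List Linear → Linear → Linear

Multi : Set
Multi = List Linear

infix 4 _≈_ _≈ₘ_ _≈ᶜ_

data _≈_ : Linear → Linear → Set where
  𝕟   : 𝕟 ≈ 𝕟
  _⊸_ : ∀ {M M′ L L′} → Permutation _≈_ M M′ → L ≈ L′ → M ⊸ L ≈ M′ ⊸ L′

_≈ₘ_ : Multi → Multi → Set
_≈ₘ_ = Permutation _≈_

infixr 5 _⊎_

_⊎_ : Multi → Multi → Multi
_⊎_ = _++_

-- The entry at position x is Γ(x). For x the variable zero, the context M ∷ Γ
-- has Γ(x) = M, and leaving the scope of x turns it into Γ.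

TyCtx : ℕ → Set
TyCtx n = Vec Multi n

_≈ᶜ_ : ∀ {n} → TyCtx n → TyCtx n → Set
_≈ᶜ_ = Pointwise _≈ₘ_

∅ : ∀ {n} → TyCtx n
∅ = Vec.replicate _ []

_∶[_] : ∀ {n} → Fin n → Linear → TyCtx n
x ∶[ L ] = ∅ Vec.[ x ]≔ [ L ]

infixr 5 _⊎ᶜ_

_⊎ᶜ_ : ∀ {n} → TyCtx n → TyCtx n → TyCtx n
_⊎ᶜ_ = Vec.zipWith _⊎_

-- Γ ⊢[ m , e ] t ∶ L and Γ ⊢ₘ[ m , e ] t ∶ M are the linear and the multi typing
-- judgements. The rules conv and convₘ only express that types are considered
-- up to reordering of multisets. The rule (many) is given by its empty instance
-- and by the addition of one premise.

infix 3 _⊢[_,_]_∶_ _⊢ₘ[_,_]_∶_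

mutual
  data _⊢[_,_]_∶_ {n : ℕ} : TyCtx n → ℕ → ℕ → Term n → Linear → Set where
    ax   : ∀ {x L} →
           x ∶[ L ] ⊢[ 0 , 1 ] var x ∶ L
    axλ  : ∀ {t} →
           ∅ ⊢[ 0 , 0 ] ƛ t ∶ 𝕟
    lam  : ∀ {Γ M L m e t} →
           M ∷ Γ ⊢[ m , e ] t ∶ L →
           Γ ⊢[ m , e ] ƛ t ∶ M ⊸ L
    app  : ∀ {Γ Δ M L m e m′ e′ t u} →
           Γ ⊢[ m , e ] t ∶ M ⊸ L →
           Δ ⊢ₘ[ m′ , e′ ] u ∶ M ⊎ [ 𝕟 ] →
           Γ ⊎ᶜ Δ ⊢[ m + m′ + 1 , e + e′ ] t · u ∶ L
    es   : ∀ {Γ Δ M L m e m′ e′ t u} →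
           M ∷ Γ ⊢[ m , e ] t ∶ L →
           Δ ⊢ₘ[ m′ , e′ ] u ∶ M ⊎ [ 𝕟 ] →
           Γ ⊎ᶜ Δ ⊢[ m + m′ , e + e′ ] t [∖ u ] ∶ L
    conv : ∀ {Γ Γ′ L L′ m e t} →
           Γ ≈ᶜ Γ′ → L ≈ L′ →
           Γ ⊢[ m , e ] t ∶ L →
           Γ′ ⊢[ m , e ] t ∶ L′

  data _⊢ₘ[_,_]_∶_ {n : ℕ} : TyCtx n → ℕ → ℕ → Term n → Multi → Set where
    none  : ∀ {t} →
            ∅ ⊢ₘ[ 0 , 0 ] t ∶ []
    more  : ∀ {Γ Δ L M m e m′ e′ t} →
            Γ ⊢[ m , e ] t ∶ L →
            Δ ⊢ₘ[ m′ , e′ ] t ∶ M →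
            Γ ⊎ᶜ Δ ⊢ₘ[ m + m′ , e + e′ ] t ∶ L ∷ M
    convₘ : ∀ {Γ Γ′ M M′ m e t} →
            Γ ≈ᶜ Γ′ → M ≈ₘ M′ →
            Γ ⊢ₘ[ m , e ] t ∶ M →
            Γ′ ⊢ₘ[ m , e ] t ∶ M′

{-# OPTIONS --safe #-}
module Submission where

-- A closed term that is not an answer has a →y redex which is not a garbage
-- collection, and in a derivation of type 𝕟 that redex is typed exactly once:
-- the only silly contexts entering arguments are a[x∖A] with a an answer, and
-- an answer of type 𝕟 uses no variable, so its arguments are typed by [𝕟].
-- Hence an m step lowers the first counter by one, and an e step, which replaces
-- an axiom by one of the derivations for u, lowers the second by one. On an
-- answer both counters are 0. Erasing then needs no types: the weak redexes of
-- an answer are all garbage collections, they are in auxiliary position, and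
-- each removes one explicit substitution.

open import Defs
open import Algebra.Bundles using (CommutativeMonoid)
import Algebra.Construct.DirectProduct as DirectProduct
import Algebra.Properties.CommutativeSemigroup as CommutativeSemigroupProperties
open import Data.Empty using (⊥-elim)
open import Data.Fin.Base using (Fin; zero; suc)
open import Data.List.Base using ([]; _∷_; [_])
open import Data.List.Relation.Binary.Permutation.Homogeneous using (refl; prep; swap; trans)
import Data.List.Relation.Binary.Permutation.Setoid.Properties as PermutationProperties
import Data.List.Relation.Binary.Pointwise.Base as List
open import Data.Nat.Base using (ℕ; zero; suc; _+_; _<_; s≤s)
open import Data.Nat.Induction using (Acc; acc; <-wellFounded)
open import Data.Nat.Properties using (+-0-commutativeMonoid; +-identityʳ; +-suc; +-assoc; +-monoˡ-<; +-monoʳ-<; ≤-refl; ≤-reflexive)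
open import Data.Product.Base using (Σ-syntax; ∃-syntax; _×_; _,_; proj₁; proj₂)
open import Data.Sum.Base using (inj₁; inj₂) renaming (_⊎_ to _or_)
open import Data.Unit.Base using (⊤; tt)
open import Data.Vec.Base using ([]; _∷_)
import Data.Vec.Relation.Binary.Pointwise.Inductive as Vec
open import Data.Vec.Relation.Binary.Pointwise.Inductive using ([]; _∷_)
open import Function.Base using (id)
open import Level using (0ℓ)
open import Relation.Binary.Bundles using (Setoid)
open import Relation.Binary.Construct.Closure.ReflexiveTransitive using (ε; _◅_)
open import Relation.Binary.PropositionalEquality.Core using (_≡_; refl; sym; cong; cong₂; subst) renaming (trans to ≡-trans)
open import Relation.Binary.PropositionalEquality.Properties using (module ≡-Reasoning)
open import Relation.Nullary.Decidable.Core using (Dec; yes; no)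
open import Relation.Nullary.Negation.Core using (¬_)

-- Resources

mutual
  ≈-refl : ∀ {L} → L ≈ L
  ≈-refl {𝕟}     = 𝕟
  ≈-refl {M ⊸ L} = refl ≋-refl ⊸ ≈-refl

  ≋-refl : ∀ {M} → List.Pointwise _≈_ M M
  ≋-refl {[]}    = List.[]
  ≋-refl {L ∷ M} = ≈-refl List.∷ ≋-refl

mutual
  ≈-sym : ∀ {L L′} → L ≈ L′ → L′ ≈ L
  ≈-sym 𝕟       = 𝕟
  ≈-sym (p ⊸ q) = ≈ₘ-sym p ⊸ ≈-sym q

  ≈ₘ-sym : ∀ {M M′} → M ≈ₘ M′ → M′ ≈ₘ M
  ≈ₘ-sym (refl p)     = refl (≋-sym p)
  ≈ₘ-sym (prep p q)   = prep (≈-sym p) (≈ₘ-sym q)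
  ≈ₘ-sym (swap p q r) = swap (≈-sym q) (≈-sym p) (≈ₘ-sym r)
  ≈ₘ-sym (trans p q)  = trans (≈ₘ-sym q) (≈ₘ-sym p)

  ≋-sym : ∀ {M M′} → List.Pointwise _≈_ M M′ → List.Pointwise _≈_ M′ M
  ≋-sym List.[]       = List.[]
  ≋-sym (p List.∷ ps) = ≈-sym p List.∷ ≋-sym ps

≈-trans : ∀ {L L′ L″} → L ≈ L′ → L′ ≈ L″ → L ≈ L″
≈-trans 𝕟       𝕟         = 𝕟
≈-trans (p ⊸ q) (p′ ⊸ q′) = trans p p′ ⊸ ≈-trans q q′

linearSetoid : Setoid 0ℓ 0ℓ
linearSetoid = record
  { Carrier = Linear ; _≈_ = _≈_
  ; isEquivalence = record { refl = ≈-refl ; sym = ≈-sym ; trans = ≈-trans } }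

module Mul = CommutativeMonoid (PermutationProperties.++-commutativeMonoid linearSetoid)

⊎ᶜ-commutativeMonoid : ℕ → CommutativeMonoid 0ℓ 0ℓ
⊎ᶜ-commutativeMonoid n = record
  { Carrier = TyCtx n ; _≈_ = _≈ᶜ_ ; _∙_ = _⊎ᶜ_ ; ε = ∅
  ; isCommutativeMonoid = record
    { isMonoid = record
      { isSemigroup = record
        { isMagma = record
          { isEquivalence = Vec.isEquivalence Mul.isEquivalence n
          ; ∙-cong = cong-⊎ᶜ }
        ; assoc = assoc }
      ; identity = identityˡ , identityʳ }
    ; comm = comm } }
  where
  cong-⊎ᶜ : ∀ {n} {Γ Γ′ Δ Δ′ : TyCtx n} → Γ ≈ᶜ Γ′ → Δ ≈ᶜ Δ′ → Γ ⊎ᶜ Δ ≈ᶜ Γ′ ⊎ᶜ Δ′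
  cong-⊎ᶜ []       []       = []
  cong-⊎ᶜ (p ∷ ps) (q ∷ qs) = Mul.∙-cong p q ∷ cong-⊎ᶜ ps qs

  assoc : ∀ {n} (Γ Δ Θ : TyCtx n) → (Γ ⊎ᶜ Δ) ⊎ᶜ Θ ≈ᶜ Γ ⊎ᶜ (Δ ⊎ᶜ Θ)
  assoc []      []      []      = []
  assoc (M ∷ Γ) (N ∷ Δ) (P ∷ Θ) = Mul.assoc M N P ∷ assoc Γ Δ Θ

  identityˡ : ∀ {n} (Γ : TyCtx n) → ∅ ⊎ᶜ Γ ≈ᶜ Γ
  identityˡ []      = []
  identityˡ (M ∷ Γ) = Mul.identityˡ M ∷ identityˡ Γ

  identityʳ : ∀ {n} (Γ : TyCtx n) → Γ ⊎ᶜ ∅ ≈ᶜ Γ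
  identityʳ []      = []
  identityʳ (M ∷ Γ) = Mul.identityʳ M ∷ identityʳ Γ

  comm : ∀ {n} (Γ Δ : TyCtx n) → Γ ⊎ᶜ Δ ≈ᶜ Δ ⊎ᶜ Γ
  comm []      []      = []
  comm (M ∷ Γ) (N ∷ Δ) = Mul.comm M N ∷ comm Γ Δ

-- A resource is a type context together with the two counters of a judgement.

resources : ℕ → CommutativeMonoid 0ℓ 0ℓ
resources n = DirectProduct.commutativeMonoid (⊎ᶜ-commutativeMonoid n)
  (DirectProduct.commutativeMonoid +-0-commutativeMonoid +-0-commutativeMonoid)

module R {n : ℕ} where
  open CommutativeMonoid (resources n) public
  open CommutativeSemigroupProperties commutativeSemigroup public
    using (x∙yz≈y∙xz; xy∙z≈xz∙y)

open R using (_∙_) renaming (_≈_ to _≈ᴿ_)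

Res : ℕ → Set
Res n = TyCtx n × ℕ × ℕ

infixr 5 _◂_

_◂_ : ∀ {n} → Multi → Res n → Res (suc n)
M ◂ (Γ , k) = M ∷ Γ , k

cost : ∀ {n} → ℕ × ℕ → Res n
cost k = ∅ , k

-- The price of one rule (@), hence of one m step, and of one axiom, hence of one e step.
pattern mult = 1 , 0
pattern expo = 0 , 1

use : ∀ {n} → Fin n → Linear → Res n
use x L = x ∶[ L ] , expo

-- The type system over resources: conversion is pushed to the side conditions,
-- so that inverting a derivation is pattern matching.

infix 3 _⊩_∶_ _⊩ₘ_∶_

mutual
  data _⊩_∶_ {n : ℕ} (R : Res n) : Term n → Linear → Set where
    ax  : ∀ {x L} → R ≈ᴿ use x L → R ⊩ var x ∶ L
    axλ : ∀ {t} → R ≈ᴿ R.ε → R ⊩ ƛ t ∶ 𝕟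
    lam : ∀ {M L t} → M ◂ R ⊩ t ∶ L → R ⊩ ƛ t ∶ M ⊸ L
    app : ∀ {R₁ R₂ M L t u} → R ≈ᴿ (R₁ ∙ R₂) ∙ cost mult →
          R₁ ⊩ t ∶ M ⊸ L → R₂ ⊩ₘ u ∶ M ⊎ [ 𝕟 ] → R ⊩ t · u ∶ L
    es  : ∀ {R₁ R₂ M L t u} → R ≈ᴿ R₁ ∙ R₂ →
          M ◂ R₁ ⊩ t ∶ L → R₂ ⊩ₘ u ∶ M ⊎ [ 𝕟 ] → R ⊩ t [∖ u ] ∶ L

  data _⊩ₘ_∶_ {n : ℕ} (R : Res n) : Term n → Multi → Set where
    none : ∀ {t} → R ≈ᴿ R.ε → R ⊩ₘ t ∶ []
    more : ∀ {R₁ R₂ L M t} → R ≈ᴿ R₁ ∙ R₂ →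
           R₁ ⊩ t ∶ L → R₂ ⊩ₘ t ∶ M → R ⊩ₘ t ∶ L ∷ M

∶[]-cong : ∀ {n} (x : Fin n) {L L′} → L ≈ L′ → x ∶[ L ] ≈ᶜ x ∶[ L′ ]
∶[]-cong zero    p = prep p Mul.refl ∷ Vec.refl Mul.refl
∶[]-cong (suc x) p = Mul.refl ∷ ∶[]-cong x p

-- The multi type of a bound variable is an entry of the resource, so reordering the domain of an
-- arrow is reordering the resource of the premise.
convert : ∀ {n} {R R′ : Res n} {t L L′} → R ≈ᴿ R′ → L ≈ L′ → R ⊩ t ∶ L → R′ ⊩ t ∶ L′
convert r l       (ax {x} p)  = ax (R.trans (R.sym r) (R.trans p (∶[]-cong x l , refl , refl)))
convert r 𝕟       (axλ p)     = axλ (R.trans (R.sym r) p)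
convert r (p ⊸ l) (lam d)     = lam (convert (p ∷ proj₁ r , proj₂ r) l d)
convert r l       (app p d D) = app (R.trans (R.sym r) p) (convert R.refl (Mul.refl ⊸ l) d) D
convert r l       (es p d D)  = es (R.trans (R.sym r) p) (convert R.refl l d) D

transport : ∀ {n} {R R′ : Res n} {t L} → R ≈ᴿ R′ → R ⊩ t ∶ L → R′ ⊩ t ∶ L
transport r = convert r ≈-refl

transportₘ : ∀ {n} {R R′ : Res n} {t M} → R ≈ᴿ R′ → R ⊩ₘ t ∶ M → R′ ⊩ₘ t ∶ M
transportₘ r (none p)     = none (R.trans (R.sym r) p)
transportₘ r (more p d D) = more (R.trans (R.sym r) p) d D

convert-≋ : ∀ {n} {R : Res n} {t M M′} → List.Pointwise _≈_ M M′ → R ⊩ₘ t ∶ M → R ⊩ₘ t ∶ M′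
convert-≋ List.[]       D            = D
convert-≋ (p List.∷ ps) (more r d D) = more r (convert R.refl p d) (convert-≋ ps D)

convertₘ : ∀ {n} {R : Res n} {t M M′} → M ≈ₘ M′ → R ⊩ₘ t ∶ M → R ⊩ₘ t ∶ M′
convertₘ (refl ps)    D            = convert-≋ ps D
convertₘ (prep p q)   (more r d D) = more r (convert R.refl p d) (convertₘ q D)
convertₘ (swap p q s) (more {R₁} r d (more {R₂} {R₃} r′ d′ D)) =
  more (R.trans r (R.trans (R.∙-congˡ r′) (R.x∙yz≈y∙xz R₁ R₂ R₃)))
    (convert R.refl q d′)
    (more R.refl (convert R.refl p d) (convertₘ s D))
convertₘ (trans p q) D = convertₘ q (convertₘ p D)

mutual
  embed : ∀ {n} {Γ : TyCtx n} {m e t L} → Γ ⊢[ m , e ] t ∶ L → (Γ , m , e) ⊩ t ∶ L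
  embed ax          = ax R.refl
  embed axλ         = axλ R.refl
  embed (lam d)     = lam (embed d)
  embed (app {Γ} {Δ} {e = e} {e′ = e′} d D) =
    -- The `+ 1` of the rule is that of `cost mult`; its empty context and its `0` have to be
    -- absorbed.
    app (TC.sym (TC.identityʳ (Γ ⊎ᶜ Δ)) , refl , sym (+-identityʳ (e + e′))) (embed d) (embedₘ D)
    where module TC = CommutativeMonoid (⊎ᶜ-commutativeMonoid _)
  embed (es d D)     = es R.refl (embed d) (embedₘ D)
  embed (conv r l d) = convert (r , refl , refl) l (embed d)

  embedₘ : ∀ {n} {Γ : TyCtx n} {m e t M} → Γ ⊢ₘ[ m , e ] t ∶ M → (Γ , m , e) ⊩ₘ t ∶ M
  embedₘ none          = none R.refl
  embedₘ (more d D)    = more R.refl (embed d) (embedₘ D)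
  embedₘ (convₘ r p D) = transportₘ (r , refl , refl) (convertₘ p (embedₘ D))

-- Renaming

ext-fusion : ∀ {i j k} {ρ : Fin j → Fin k} {σ : Fin i → Fin j} {τ : Fin i → Fin k} →
             (∀ x → ρ (σ x) ≡ τ x) → ∀ x → ext ρ (ext σ x) ≡ ext τ x
ext-fusion h zero    = refl
ext-fusion h (suc x) = cong suc (h x)

rename-fusion : ∀ {i j k} {ρ : Fin j → Fin k} {σ : Fin i → Fin j} {τ : Fin i → Fin k} →
                (∀ x → ρ (σ x) ≡ τ x) → ∀ t → rename ρ (rename σ t) ≡ rename τ t
rename-fusion h (var x)    = cong var (h x)
rename-fusion h (ƛ t)      = cong ƛ (rename-fusion (ext-fusion h) t)
rename-fusion h (t · u)    = cong₂ _·_ (rename-fusion h t) (rename-fusion h u)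
rename-fusion h (t [∖ u ]) = cong₂ _[∖_] (rename-fusion (ext-fusion h) t) (rename-fusion h u)

rename-identity : ∀ {n} {ρ : Fin n → Fin n} → (∀ x → ρ x ≡ x) → ∀ t → rename ρ t ≡ t
rename-identity h (var x)    = cong var (h x)
rename-identity h (ƛ t)      = cong ƛ (rename-identity (λ { zero → refl ; (suc x) → cong suc (h x) }) t)
rename-identity h (t · u)    = cong₂ _·_ (rename-identity h t) (rename-identity h u)
rename-identity h (t [∖ u ]) =
  cong₂ _[∖_] (rename-identity (λ { zero → refl ; (suc x) → cong suc (h x) }) t) (rename-identity h u)

-- Only the renamings obtained from `suc` by passing under binders; on these `weaken` is a plain
-- recursion.
data Weakening : ∀ {i j} → (Fin i → Fin j) → Set where
  skip : ∀ {n} → Weakening (suc {n})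
  keep : ∀ {i j} {ρ : Fin i → Fin j} → Weakening ρ → Weakening (ext ρ)

weaken : ∀ {i j} {ρ : Fin i → Fin j} → Weakening ρ → TyCtx i → TyCtx j
weaken skip     Γ       = [] ∷ Γ
weaken (keep w) (M ∷ Γ) = M ∷ weaken w Γ

weaken-∅ : ∀ {i j} {ρ : Fin i → Fin j} (w : Weakening ρ) → weaken w ∅ ≡ ∅
weaken-∅ skip     = refl
weaken-∅ (keep w) = cong ([] ∷_) (weaken-∅ w)

weaken-∶[] : ∀ {i j} {ρ : Fin i → Fin j} (w : Weakening ρ) x {L} → weaken w (x ∶[ L ]) ≡ ρ x ∶[ L ]
weaken-∶[] skip     x       = refl
weaken-∶[] (keep w) zero    = cong (_ ∷_) (weaken-∅ w)
weaken-∶[] (keep w) (suc x) = cong ([] ∷_) (weaken-∶[] w x)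

weaken-⊎ᶜ : ∀ {i j} {ρ : Fin i → Fin j} (w : Weakening ρ) Γ Δ →
            weaken w (Γ ⊎ᶜ Δ) ≡ weaken w Γ ⊎ᶜ weaken w Δ
weaken-⊎ᶜ skip     Γ       Δ       = refl
weaken-⊎ᶜ (keep w) (M ∷ Γ) (N ∷ Δ) = cong (_ ∷_) (weaken-⊎ᶜ w Γ Δ)

weaken-cong : ∀ {i j} {ρ : Fin i → Fin j} (w : Weakening ρ) {Γ Δ} →
              Γ ≈ᶜ Δ → weaken w Γ ≈ᶜ weaken w Δ
weaken-cong skip     ps       = Mul.refl ∷ ps
weaken-cong (keep w) (p ∷ ps) = p ∷ weaken-cong w ps

weakenᴿ : ∀ {i j} {ρ : Fin i → Fin j} → Weakening ρ → Res i → Res j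
weakenᴿ w (Γ , k) = weaken w Γ , k

weakenᴿ-cong : ∀ {i j} {ρ : Fin i → Fin j} (w : Weakening ρ) {R R′ Q} →
               R ≈ᴿ R′ → weakenᴿ w R′ ≡ Q → weakenᴿ w R ≈ᴿ Q
weakenᴿ-cong w (p , q) refl = weaken-cong w p , q

weakenᴿ-∙ : ∀ {i j} {ρ : Fin i → Fin j} (w : Weakening ρ) R Q →
            weakenᴿ w (R ∙ Q) ≡ weakenᴿ w R ∙ weakenᴿ w Q
weakenᴿ-∙ w R Q = cong (_, _) (weaken-⊎ᶜ w (proj₁ R) (proj₁ Q))

mutual
  weakening : ∀ {i j} {ρ : Fin i → Fin j} (w : Weakening ρ) {R t L} →
              R ⊩ t ∶ L → weakenᴿ w R ⊩ rename ρ t ∶ L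
  weakening w (ax {x} p)  = ax (weakenᴿ-cong w p (cong (_, _) (weaken-∶[] w x)))
  weakening w (axλ p)     = axλ (weakenᴿ-cong w p (cong (_, _) (weaken-∅ w)))
  weakening w (lam d)     = lam (weakening (keep w) d)
  weakening w (app {R₁} {R₂} p d D) =
    app (weakenᴿ-cong w p (≡-trans (weakenᴿ-∙ w (R₁ ∙ R₂) (cost mult))
          (cong₂ _∙_ (weakenᴿ-∙ w R₁ R₂) (cong (_, _) (weaken-∅ w)))))
      (weakening w d) (weakeningₘ w D)
  weakening w (es {R₁} {R₂} p d D) =
    es (weakenᴿ-cong w p (weakenᴿ-∙ w R₁ R₂)) (weakening (keep w) d) (weakeningₘ w D)

  weakeningₘ : ∀ {i j} {ρ : Fin i → Fin j} (w : Weakening ρ) {R t M} →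
               R ⊩ₘ t ∶ M → weakenᴿ w R ⊩ₘ rename ρ t ∶ M
  weakeningₘ w (none p) = none (weakenᴿ-cong w p (cong (_, _) (weaken-∅ w)))
  weakeningₘ w (more {R₁} {R₂} p d D) =
    more (weakenᴿ-cong w p (weakenᴿ-∙ w R₁ R₂)) (weakening w d) (weakeningₘ w D)

-- Contexts

-- The counterpart of `lift` for resources: what comes from outside assigns [] to the variables
-- bound on the way, as plugging does not capture.
↑ : ∀ {i j} → Ctx i j → Res i → Res j
↑ □           P = P
↑ (K ·ˡ u)    P = ↑ K P
↑ (s ·ʳ K)    P = ↑ K P
↑ (s [∖ K ]ʳ) P = ↑ K P
↑ (K [∖ u ]ˡ) P = ↑ K ([] ◂ P)

↑-cost : ∀ {i j} (K : Ctx i j) k → ↑ K (cost k) ≡ cost k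
↑-cost □           k = refl
↑-cost (K ·ˡ u)    k = ↑-cost K k
↑-cost (s ·ʳ K)    k = ↑-cost K k
↑-cost (s [∖ K ]ʳ) k = ↑-cost K k
↑-cost (K [∖ u ]ˡ) k = ↑-cost K k

↑-use : ∀ {i j} (K : Ctx i j) x L → ↑ K (use x L) ≡ use (lift K x) L
↑-use □           x L = refl
↑-use (K ·ˡ u)    x L = ↑-use K x L
↑-use (s ·ʳ K)    x L = ↑-use K x L
↑-use (s [∖ K ]ʳ) x L = ↑-use K x L
↑-use (K [∖ u ]ˡ) x L = ↑-use K (suc x) L

↑-⊩ : ∀ {i j} (K : Ctx i j) {P t L} → P ⊩ t ∶ L → ↑ K P ⊩ rename (lift K) t ∶ L
↑-⊩ □ {P} {t} {L} d           = subst (P ⊩_∶ L) (sym (rename-identity (λ _ → refl) t)) d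
↑-⊩ (K ·ˡ u)    d             = ↑-⊩ K d
↑-⊩ (s ·ʳ K)    d             = ↑-⊩ K d
↑-⊩ (s [∖ K ]ʳ) d             = ↑-⊩ K d
↑-⊩ (K [∖ u ]ˡ) {P} {t} {L} d =
  subst (↑ K ([] ◂ P) ⊩_∶ L) (rename-fusion (λ _ → refl) t) (↑-⊩ K (weakening skip d))

-- In a derivation for K⟨s⟩ with K focusing, the hole is typed exactly once.
-- Whatever part P of the resource of the hole comes from outside of K can be
-- exchanged for another resource P′, changing s accordingly.

record Focus {i j} (K : Ctx i j) (H : Linear → Set) (s : Term j) (R : Res i) (L : Linear) : Set where
  field
    {L′}  : Linear
    {Q}   : Res j
    holds : H L′
    inner : Q ⊩ s ∶ L′
    trade : ∀ {P Q′} → Q ≈ᴿ ↑ K P ∙ Q′ →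
            ∃[ R′ ] (R ≈ᴿ P ∙ R′ ×
                     (∀ {P′ s′} → ↑ K P′ ∙ Q′ ⊩ s′ ∶ L′ → P′ ∙ R′ ⊩ K ⟨ s′ ⟩ ∶ L))

Focusing : ∀ {i j} → Ctx i j → Linear → (Linear → Set) → Set
Focusing K L H = ∀ {s R} → R ⊩ K ⟨ s ⟩ ∶ L → Focus K H s R L

focus-□ : ∀ {n L H} → H L → Focusing {n} □ L H
focus-□ h d = record { holds = h ; inner = d ; trade = λ q → _ , q , id }

-- The head of an application has an arrow type with an unknown domain, so the hypothesis ranges
-- over all types.
focus-app : ∀ {i j} {K : Ctx i j} {u L H} → (∀ {L} → Focusing K L H) → Focusing (K ·ˡ u) L H
focus-app focus (app {R₁} {R₂} p d D) = record
  { holds = holds ; inner = inner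
  ; trade = λ {P} q → let R′ , r , rebuild = trade q in
      (R′ ∙ R₂) ∙ cost mult
      , R.trans p (R.trans (R.∙-congʳ (R.∙-congʳ r)) (assoc P R′))
      , λ {P′} d′ → app (R.sym (assoc P′ R′)) (rebuild d′) D }
  where
  open Focus (focus d)
  assoc : ∀ P R′ → ((P ∙ R′) ∙ R₂) ∙ cost mult ≈ᴿ P ∙ ((R′ ∙ R₂) ∙ cost mult)
  assoc P R′ = R.trans (R.∙-congʳ (R.assoc P R′ R₂)) (R.assoc P (R′ ∙ R₂) (cost mult))

focus-esˡ : ∀ {i j} {K : Ctx (suc i) j} {u L H} → Focusing K L H → Focusing (K [∖ u ]ˡ) L H
focus-esˡ {K = K} {u} {L} focus {R = R} (es {R₁} {R₂} {M} p d D) = record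
  { holds = holds ; inner = inner ; trade = λ q → leave (trade q) }
  where
  open Focus (focus d)
  leave : ∀ {P Q′} →
    ∃[ R′ ] (M ◂ R₁ ≈ᴿ ([] ◂ P) ∙ R′ ×
             (∀ {P′ s′} → ↑ K P′ ∙ Q′ ⊩ s′ ∶ L′ → P′ ∙ R′ ⊩ K ⟨ s′ ⟩ ∶ L)) →
    ∃[ R′ ] (R ≈ᴿ P ∙ R′ ×
             (∀ {P′ s′} → ↑ K ([] ◂ P′) ∙ Q′ ⊩ s′ ∶ L′ → P′ ∙ R′ ⊩ K ⟨ s′ ⟩ [∖ u ] ∶ L))
  -- The traded part has [] for the bound variable, so all of `M` stays in the remainder and the
  -- derivation `D` of the argument fits again.
  leave {P} ((M′ ∷ Γ′ , k′) , (r ∷ rs , c) , rebuild) =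
    R′ ∙ R₂
    , R.trans p (R.trans (R.∙-congʳ (rs , c)) (R.assoc P R′ R₂))
    , λ {P′} d′ → es (R.sym (R.assoc P′ R′ R₂))
        (transport (≈ₘ-sym r ∷ Vec.refl Mul.refl , refl , refl) (rebuild d′)) D
    where R′ = Γ′ , k′

-- A propositional equality lets `M` be replaced by [] in the type of an argument, which leaves a
-- single premise, of type `𝕟`.
≈ₘ[]⇒≡[] : ∀ {M} → M ≈ₘ [] → M ≡ []
≈ₘ[]⇒≡[] {[]}    p = refl
≈ₘ[]⇒≡[] {L ∷ M} p = ⊥-elim (PermutationProperties.¬x∷xs↭[] linearSetoid p)

-- Only `axλ` gives type `𝕟` to an abstraction, and it is free. As the body of a substitution then
-- uses nothing, its variable has type [], and the argument is again an answer typed once, by `𝕟`.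
answer-resource : ∀ {n} {a : Term n} {R} → Answer a → R ⊩ a ∶ 𝕟 → R ≈ᴿ R.ε
answer-resource (val (ƛ t)) (axλ p) = p
answer-resource (es a a′) (es p d D) with answer-resource a d
... | r ∷ rs , c with ≈ₘ[]⇒≡[] r | D
... | refl | more q d′ (none z) =
  R.trans p (R.trans (R.∙-cong (rs , c)
    (R.trans q (R.trans (R.∙-cong (answer-resource a′ d′) z) (R.identityˡ R.ε)))) (R.identityˡ R.ε))

-- An answer of type 𝕟 uses no variable, so what is substituted in it is only
-- typed with the additional 𝕟 of the rule (ES).

focus-esʳ : ∀ {i j} {K : Ctx i j} {a H} → Answer a → Focusing K 𝕟 H → Focusing (a [∖ K ]ʳ) 𝕟 H
focus-esʳ a focus (es {R₁} p d D) with answer-resource a d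
... | r ∷ _ , _ with ≈ₘ[]⇒≡[] r | D
... | refl | more {R₂ = R₃} q d′ (none z) = record
  { holds = holds ; inner = inner
  ; trade = λ {P} eq → let R′ , r , rebuild = trade eq in
      R₁ ∙ (R′ ∙ R₃)
      , R.trans p (R.trans (R.∙-congˡ (R.trans q (R.trans (R.∙-congʳ r) (R.assoc P R′ R₃))))
                           (R.x∙yz≈y∙xz R₁ P (R′ ∙ R₃)))
      , λ {P′} d″ → es (R.x∙yz≈y∙xz P′ R₁ (R′ ∙ R₃)) d
                       (more (R.sym (R.assoc P′ R′ R₃)) (rebuild d″) (none z)) }
  where open Focus (focus d′)

Any : Linear → Set
Any _ = ⊤

focus-name : ∀ {i j} {N : Ctx i j} {L} → Name N → Focusing N L Any
focus-name □       = focus-□ tt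
focus-name (app N) = focus-app (focus-name N)
focus-name (es N)  = focus-esˡ (focus-name N)

focus-aux-∘ : ∀ {i j k} {A : Ctx i j} {K : Ctx j k} {H} → Aux A → Focusing K 𝕟 H → Focusing (A ∘ᶜ K) 𝕟 H
focus-aux-∘ □         focus = focus
focus-aux-∘ (esʳ a A) focus = focus-esʳ a (focus-aux-∘ A focus)
focus-aux-∘ (esˡ A)   focus = focus-esˡ (focus-aux-∘ A focus)

∘ᶜ-identityʳ : ∀ {i j} (K : Ctx i j) → K ∘ᶜ □ ≡ K
∘ᶜ-identityʳ □           = refl
∘ᶜ-identityʳ (K ·ˡ u)    = cong (_·ˡ u) (∘ᶜ-identityʳ K)
∘ᶜ-identityʳ (s ·ʳ K)    = cong (s ·ʳ_) (∘ᶜ-identityʳ K)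
∘ᶜ-identityʳ (s [∖ K ]ʳ) = cong (s [∖_]ʳ) (∘ᶜ-identityʳ K)
∘ᶜ-identityʳ (K [∖ u ]ˡ) = cong (_[∖ u ]ˡ) (∘ᶜ-identityʳ K)

-- Unlike a name context, an auxiliary context keeps type `𝕟` at its hole. The root context of a
-- yeAY step is silly and focuses only at `𝕟`.
focus-aux : ∀ {i j} {A : Ctx i j} → Aux A → Focusing A 𝕟 (_≡ 𝕟)
focus-aux {A = A} aux = subst (λ K → Focusing K 𝕟 (_≡ 𝕟)) (∘ᶜ-identityʳ A) (focus-aux-∘ aux (focus-□ refl))

focus-silly : ∀ {i j} {Y : Ctx i j} → Silly Y → Focusing Y 𝕟 Any
focus-silly (silly A N) = focus-aux-∘ A (focus-name N)

-- Quantitative subject reduction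

-- As `cost k` has an empty type context, one equation says both that the context is preserved and
-- that the counters drop by exactly `k`.
Spends : ∀ {n} → ℕ × ℕ → Term n → Term n → Linear → Set
Spends k t t′ L = ∀ {R} → R ⊩ t ∶ L → ∃[ R′ ] (R ≈ᴿ cost k ∙ R′ × (R′ ⊩ t′ ∶ L))

-- The price paid in the hole is the part to trade: `cost k` is exchanged for the neutral resource.
spends-closure : ∀ {i j} {K : Ctx i j} {L H k s s′} → Focusing K L H →
                 (∀ {L′} → H L′ → Spends k s s′ L′) → Spends k (K ⟨ s ⟩) (K ⟨ s′ ⟩) L
spends-closure {K = K} {k = k} focus spends d = 
  let open Focus (focus d)
      Q′ , q , d′      = spends holds inner
      R′ , r , rebuild = trade (R.trans q (R.reflexive (cong (_∙ Q′) (sym (↑-cost K k)))))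
  in R′ , r , transport (R.identityˡ R′) (rebuild {P′ = R.ε} (transport
       (R.trans (R.sym (R.identityˡ Q′)) (R.reflexive (cong (_∙ Q′) (sym (↑-cost K (0 , 0)))))) d′))

-- Up to the price of (@), which is left to `spends-m`, the rules (@) and (ES) combine their
-- premises in the same way.
beta : ∀ {i j} {S : Ctx i j} {t u M L R₁ R₂} → Subst S →
       R₁ ⊩ S ⟨ ƛ t ⟩ ∶ M ⊸ L → R₂ ⊩ₘ u ∶ M ⊎ [ 𝕟 ] →
       R₁ ∙ R₂ ⊩ S ⟨ t [∖ rename (lift S) u ] ⟩ ∶ L
beta {u = u} □ (lam d) D = es R.refl d (subst (_ ⊩ₘ_∶ _) (sym (rename-identity (λ _ → refl) u)) D)
beta {S = S [∖ _ ]ˡ} {t} {u} {L = L} {R₂ = R₂} (es s) (es {R₃} {R₄} {M′} p d D′) D =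
  es (R.trans (R.∙-congʳ p) (R.xy∙z≈xz∙y R₃ R₄ R₂))
    -- The weakened `u` contributes [] to the variable bound here.
    (transport (Mul.identityʳ M′ ∷ Vec.refl Mul.refl , refl , refl)
      (subst (λ v → (M′ ◂ R₃) ∙ ([] ◂ R₂) ⊩ S ⟨ t [∖ v ] ⟩ ∶ L) (rename-fusion (λ _ → refl) u)
        (beta s d (weakeningₘ skip D))))
    D′

spends-m : ∀ {n} {t t′ : Term n} {L} → t ↦m t′ → Spends mult t t′ L
spends-m (root S) (app {R₁} {R₂} p d D) = R₁ ∙ R₂ , R.trans p (R.comm (R₁ ∙ R₂) (cost mult)) , beta S d D

-- The hole is typed by one axiom. It is traded for a derivation of `u` at the same type, taken from
-- those that the substitution holds; the others stay there for the remaining occurrences.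
spends-e : ∀ {n j} {K : Ctx (suc n) j} {u L H} → Focusing K L H →
           Spends expo (K ⟨⟨ var zero ⟩⟩ [∖ u ]) (K ⟨⟨ wk u ⟩⟩ [∖ u ]) L
spends-e {K = K} {u} {L} focus {R} (es {R₁} {R₂} {M} p d D) with focus d
... | record { L′ = L′ ; Q = Q ; inner = ax q ; trade = trade } = replace (trade q′)
  where
  q′ : Q ≈ᴿ ↑ K (use zero L′) ∙ R.ε
  q′ = R.trans q (R.trans (R.reflexive (sym (↑-use K zero L′))) (R.sym (R.identityʳ _)))

  replace : ∃[ R′ ] (M ◂ R₁ ≈ᴿ use zero L′ ∙ R′ ×
                     (∀ {P′ s′} → ↑ K P′ ∙ R.ε ⊩ s′ ∶ L′ → P′ ∙ R′ ⊩ K ⟨ s′ ⟩ ∶ L)) →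
            ∃[ R′ ] (R ≈ᴿ cost expo ∙ R′ × (R′ ⊩ K ⟨⟨ wk u ⟩⟩ [∖ u ] ∶ L))
  -- By `r`, `M` is `L′ ∷ M′` up to order, so converting `D` brings the premise for `L′` to the
  -- front.
  replace ((M′ ∷ Γ′ , k′) , (r ∷ rs , c) , rebuild) with convertₘ (Mul.∙-congʳ r) D
  ... | more {R₃} {R₄} q₂ d′ D′ =
    (R₃ ∙ R′) ∙ R₄
    , R.trans p (R.trans (R.∙-cong (rs , c) q₂)
        (R.trans (R.assoc (cost expo) R′ (R₃ ∙ R₄))
          (R.∙-congˡ {x = cost expo} (R.trans (R.x∙yz≈y∙xz R′ R₃ R₄) (R.sym (R.assoc R₃ R′ R₄))))))
    , es R.refl (rebuild (transport (R.sym (R.identityʳ _)) (↑-⊩ K (weakening skip d′)))) D′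
    where R′ = Γ′ , k′

spends-ym : ∀ {n} {t t′ : Term n} → t →ym t′ → Spends mult t t′ 𝕟
spends-ym (inside Y r) = spends-closure (focus-silly Y) (λ _ → spends-m r)

spends-yeAY : ∀ {n} {t t′ : Term n} → t →yeAY t′ → Spends expo t t′ 𝕟
spends-yeAY (inside A (root Y)) = spends-closure (focus-aux A) (λ { refl → spends-e (focus-silly Y) })

spends-yeYN : ∀ {n} {t t′ : Term n} → t →yeYN t′ → Spends expo t t′ 𝕟
spends-yeYN (inside Y (root N)) = spends-closure (focus-silly Y) (λ _ → spends-e (focus-name N))

-- Progress

-- The view descends under substitutions, hence open terms. The variable of `stuck` is free in the
-- whole term, and the substitution that binds it makes an e redex.
data NameView {n} : Term n → Set where
  value  : ∀ {j} {S : Ctx n j} {s} → Subst S → NameView (S ⟨ ƛ s ⟩)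
  stuck  : ∀ {j} {N : Ctx n j} → Name N → ∀ x → NameView (N ⟨⟨ var x ⟩⟩)
  m-step : ∀ {t t′} → Closure Name _↦m_ t t′ → NameView t
  e-step : ∀ {t t′} → Closure Name (RootE Name) t t′ → NameView t

name-view : ∀ {n} (t : Term n) → NameView t
name-view (var x) = stuck □ x
name-view (ƛ t)   = value □
name-view (t · u) with name-view t
... | value S               = m-step (inside □ (root S))
... | stuck N x             = stuck (app N) x
... | m-step (inside N r)   = m-step (inside (app N) r)
... | e-step (inside N r)   = e-step (inside (app N) r)
name-view (t [∖ u ]) with name-view t
... | value S               = value (es S)
... | stuck N zero          = e-step (inside □ (root N))
... | stuck N (suc x)       = stuck (es N) x
... | m-step (inside N r)   = m-step (inside (es N) r)
... | e-step (inside N r)   = e-step (inside (es N) r)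

data SillyView {n} : Term n → Set where
  answer : ∀ {a} → Answer a → SillyView a
  stuck  : ∀ {j} {Y : Ctx n j} → Silly Y → ∀ x → SillyView (Y ⟨⟨ var x ⟩⟩)
  ym     : ∀ {t t′} → t →ym t′ → SillyView t
  yeAY   : ∀ {t t′} → t →yeAY t′ → SillyView t
  yeYN   : ∀ {t t′} → t →yeYN t′ → SillyView t

silly-view : ∀ {n} (t : Term n) → SillyView t
silly-view (var x) = stuck (silly □ □) x
silly-view (ƛ t)   = answer (val (ƛ t))
-- No auxiliary context enters an application, so its head is evaluated by name.
silly-view (t · u) with name-view t
... | value S             = ym (inside (silly □ □) (root S))
... | stuck N x           = stuck (silly □ (app N)) x
... | m-step (inside N r) = ym (inside (silly □ (app N)) r)
... | e-step (inside N r) = yeYN (inside (silly □ (app N)) r)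
silly-view (t [∖ u ]) with silly-view t
... | stuck Y zero                = yeAY (inside □ (root Y))
... | stuck (silly A N) (suc x)   = stuck (silly (esˡ A) N) x
... | ym (inside (silly A N) r)   = ym (inside (silly (esˡ A) N) r)
... | yeAY (inside A r)           = yeAY (inside (esˡ A) r)
... | yeYN (inside (silly A N) r) = yeYN (inside (silly (esˡ A) N) r)
-- The argument is evaluated whether or not its variable occurs in the answer.
... | answer a with silly-view u
...   | answer a′                   = answer (es a a′)
...   | stuck (silly A N) x         = stuck (silly (esʳ a A) N) x
...   | ym (inside (silly A N) r)   = ym (inside (silly (esʳ a A) N) r)
...   | yeAY (inside A r)           = yeAY (inside (esʳ a A) r)
...   | yeYN (inside (silly A N) r) = yeYN (inside (silly (esʳ a A) N) r)

-- Garbage collection of answers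

renaming-ext? : ∀ {i j} {ρ : Fin i → Fin j} → (∀ y → Dec (∃[ x ] ρ x ≡ y)) →
                ∀ y → Dec (∃[ x ] ext ρ x ≡ y)
renaming-ext? ρ? zero    = yes (zero , refl)
renaming-ext? ρ? (suc y) with ρ? y
... | yes (x , refl) = yes (suc x , refl)
... | no ¬x          = no λ { (suc x , refl) → ¬x (x , refl) }

-- Decides the side condition of gcv, encoded as being of the form `wk s`. Going under binders takes
-- `suc` to other renamings with decidable image.
renaming? : ∀ {i j} {ρ : Fin i → Fin j} → (∀ y → Dec (∃[ x ] ρ x ≡ y)) →
            ∀ t → Dec (∃[ s ] rename ρ s ≡ t)
renaming? ρ? (var y) with ρ? y
... | yes (x , refl) = yes (var x , refl)
... | no ¬x          = no λ { (var x , refl) → ¬x (x , refl) }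
renaming? ρ? (ƛ t) with renaming? (renaming-ext? ρ?) t
... | yes (s , refl) = yes (ƛ s , refl)
... | no ¬s          = no λ { (ƛ s , refl) → ¬s (s , refl) }
renaming? ρ? (t · u) with renaming? ρ? t | renaming? ρ? u
... | yes (s , refl) | yes (r , refl) = yes (s · r , refl)
... | no ¬s          | _              = no λ { (s · r , refl) → ¬s (s , refl) }
... | yes _          | no ¬r          = no λ { (s · r , refl) → ¬r (r , refl) }
renaming? ρ? (t [∖ u ]) with renaming? (renaming-ext? ρ?) t | renaming? ρ? u
... | yes (s , refl) | yes (r , refl) = yes (s [∖ r ] , refl)
... | no ¬s          | _              = no λ { (s [∖ r ] , refl) → ¬s (s , refl) }
... | yes _          | no ¬r          = no λ { (s [∖ r ] , refl) → ¬r (r , refl) }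

suc? : ∀ {n} (y : Fin (suc n)) → Dec (∃[ x ] suc x ≡ y)
suc? zero    = no λ ()
suc? (suc y) = yes (y , refl)

answer-rename⁻ : ∀ {i j} {ρ : Fin i → Fin j} t → Answer (rename ρ t) → Answer t
answer-rename⁻ (ƛ t)      _         = val (ƛ t)
answer-rename⁻ (t [∖ u ]) (es a a′) = es (answer-rename⁻ t a) (answer-rename⁻ u a′)
answer-rename⁻ (var x)    (val ())
answer-rename⁻ (t · u)    (val ())

answer-rename : ∀ {i j} (ρ : Fin i → Fin j) {t} → Answer t → Answer (rename ρ t)
answer-rename ρ (val (ƛ t)) = val (ƛ _)
answer-rename ρ (es a a′)   = es (answer-rename (ext ρ) a) (answer-rename ρ a′)

-- The function in the view records that `S` holds only answers, so that collecting yields an answer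
-- again.
data AnswerView {n} : Term n → Set where
  view : ∀ {j} {S : Ctx n j} {v} → Subst S → Value v →
         (∀ {s} → Answer s → Answer (S ⟨ s ⟩)) → AnswerView (S ⟨ v ⟩)

answer-view : ∀ {n} {a : Term n} → Answer a → AnswerView a
answer-view (val v) = view □ v id
answer-view (es a a′) with answer-view a
... | view S v plug = view (es S) v (λ s → es (plug s) a′)

-- The zeros are harmless: only answers are measured, and weak contexts do not enter abstractions.
#es : ∀ {n} → Term n → ℕ
#es (var x)    = 0
#es (ƛ t)      = 0
#es (t · u)    = 0
#es (t [∖ u ]) = suc (#es t + #es u)

#es-rename : ∀ {i j} (ρ : Fin i → Fin j) t → #es (rename ρ t) ≡ #es t
#es-rename ρ (var x)    = refl
#es-rename ρ (ƛ t)      = refl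
#es-rename ρ (t · u)    = refl
#es-rename ρ (t [∖ u ]) = cong₂ (λ a b → suc (a + b)) (#es-rename (ext ρ) t) (#es-rename ρ u)

#es-plug : ∀ {i j} {S : Ctx i j} {v} s → Subst S → Value v → #es (S ⟨ s ⟩) ≡ #es s + #es (S ⟨ v ⟩)
#es-plug s □ (ƛ _) = sym (+-identityʳ (#es s))
#es-plug {S = S [∖ u ]ˡ} {v} s (es p) w = begin
  suc (#es (S ⟨ s ⟩) + #es u)           ≡⟨ cong (λ a → suc (a + #es u)) (#es-plug s p w) ⟩
  suc (#es s + #es (S ⟨ v ⟩) + #es u)   ≡⟨ cong suc (+-assoc (#es s) _ _) ⟩
  suc (#es s + (#es (S ⟨ v ⟩) + #es u)) ≡⟨ +-suc (#es s) _ ⟨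
  #es s + suc (#es (S ⟨ v ⟩) + #es u)   ∎
  where open ≡-Reasoning

data Collected {n} : Term n → Set where
  val : ∀ {v} → Value v → Collected v
  es  : ∀ {a a′} → Collected a → Collected a′ → ¬ (∃[ s ] wk s ≡ a) → Collected (a [∖ a′ ])

collected-inside : ∀ {i j} (K : Ctx i j) {t} → Collected (K ⟨ t ⟩) → Collected t
collected-inside □           c           = c
collected-inside (s [∖ K ]ʳ) (es _ c _)  = collected-inside K c
collected-inside (K [∖ u ]ˡ) (es c _ _)  = collected-inside K c
collected-inside (K ·ˡ u)    (val ())
collected-inside (s ·ʳ K)    (val ())

-- An m redex puts an application in weak position and an e redex a variable, and a collected term
-- has neither; garbage is excluded by the last field of `es`.
collected-normal : ∀ {n} {t : Term n} → Collected t → WNormal t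
collected-normal c _ (wm (inside {K = K} _ (root _))) with collected-inside K c
... | val ()
collected-normal c _ (we (inside {K = K} _ (root {K = K′} _))) with collected-inside K c
... | es c′ _ _ with collected-inside K′ c′
...   | val ()
collected-normal c _ (wgcv (inside {K = K} _ (root _ _))) with collected-inside K c
... | es _ _ ¬s = ¬s (_ , refl)

collect-step : ∀ {n} {a : Term n} → Answer a →
               Collected a or ∃[ b ] (Answer b × a →ygcv b × #es b < #es a)
collect-step (val v) = inj₁ (val v)
collect-step (es {a} {a′} A A′) with collect-step A
... | inj₂ (b , B , inside (silly X N) r , lt) =
  inj₂ (b [∖ a′ ] , es B A′ , inside (silly (esˡ X) N) r , s≤s (+-monoˡ-< (#es a′) lt))
... | inj₁ c with collect-step A′
...   | inj₂ (b , B , inside (silly X N) r , lt) =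
  inj₂ (a [∖ b ] , es A B , inside (silly (esʳ A X) N) r , s≤s (+-monoʳ-< (#es a) lt))
...   | inj₁ c′ with renaming? suc? a
...     | no ¬s = inj₁ (es c c′ ¬s)
...     | yes (s , refl) with answer-view A′
...       | view {S = S} {v} p w plug =
  inj₂ (S ⟨⟨ s ⟩⟩ , plug (answer-rename (lift S) (answer-rename⁻ s A))
       , inside (silly □ □) (root p w)
       -- `S` moves outwards with its substitutions; exactly the collected one disappears, which the
       -- `s≤s` accounts for.
       , s≤s (≤-reflexive (begin
           #es (S ⟨⟨ s ⟩⟩)                         ≡⟨ #es-plug (rename (lift S) s) p w ⟩
           #es (rename (lift S) s) + #es (S ⟨ v ⟩) ≡⟨ cong (_+ #es (S ⟨ v ⟩)) (#es-rename (lift S) s) ⟩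
           #es s + #es (S ⟨ v ⟩)                   ≡⟨ cong (_+ #es (S ⟨ v ⟩)) (#es-rename suc s) ⟨
           #es (wk s) + #es (S ⟨ v ⟩)              ∎)))
  where open ≡-Reasoning

-- Evaluation of typed closed terms

NormalizesIn : ∀ {n} → Term n → ℕ → ℕ → Set
NormalizesIn {n} t m e = Σ[ u ∈ Term n ] WNormal u × (Σ[ d ∈ t →y* u ] (#m d ≡ m × #e d ≡ e))

collect : ∀ {n} {a : Term n} → Answer a → Acc _<_ (#es a) → NormalizesIn a 0 0
collect A (acc rec) with collect-step A
... | inj₁ c = _ , collected-normal c , ε , refl , refl
... | inj₂ (b , B , r , lt) =
  let u , normal , d , p , q = collect B (rec lt) in u , normal , ygcv r ◅ d , p , q

evaluate : ∀ {t : Term 0} {m e} → ([] , m , e) ⊩ t ∶ 𝕟 → Acc _<_ (m + e) → NormalizesIn t m e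
evaluate {t} d (acc rec) with silly-view t
... | answer A with answer-resource A d
-- The neutral resource makes both counters 0, and collecting adds to neither.
...   | _ , refl , refl = collect A (<-wellFounded _)
evaluate d (acc rec) | ym r with spends-ym r d
-- In the empty scope the equation is one of numbers: the first counter is a successor and the
-- second is unchanged.
...   | ([] , _) , (_ , refl , refl) , d′ =
  let u , normal , s , p , q = evaluate d′ (rec ≤-refl) in u , normal , ym r ◅ s , cong suc p , q
evaluate {m = m} d (acc rec) | yeAY r with spends-yeAY r d
...   | ([] , _) , (_ , refl , refl) , d′ =
  let u , normal , s , p , q = evaluate d′ (rec (≤-reflexive (sym (+-suc m _)))) in
  u , normal , yeAY r ◅ s , p , cong suc q
evaluate {m = m} d (acc rec) | yeYN r with spends-yeYN r d
...   | ([] , _) , (_ , refl , refl) , d′ =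
  let u , normal , s , p , q = evaluate d′ (rec (≤-reflexive (sym (+-suc m _)))) in
  u , normal , yeYN r ◅ s , p , cong suc q

theorem12p5 : (t : Term 0) (m e : ℕ) → ∅ ⊢[ m , e ] t ∶ 𝕟 →
    Σ[ n ∈ Term 0 ] WNormal n × (Σ[ d ∈ t →y* n ] (#m d ≡ m × #e d ≡ e))
theorem12p5 t m e d = evaluate (embed d) (<-wellFounded _)
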